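{- Let $(\mathcal{A},\otimes,I)$ be a locally small, monoidally well-pointed $\dagger$-symmetric monoidal category with finite $\dagger$-biproducts, and let $(X,\mu)$ be an $H^*$-algebra in $\mathcal{A}$. For each point $x:I\to X$ put $R_x=\mu\circ(x\otimes\mathrm{id}_X)\circ\lambda_X^{ -1}:X\to X$, where $\lambda_X:I\otimes X\to X$ is the left unitor, and let $R(\mu)=\{R_x \mid x:I\to X\}\subseteq \mathrm{Hom}(X,X)$. Then the commutant $R(\mu)'$ is a maximal commutative von Neumann $S^*$-semialgebra in $\mathrm{Hom}(X,X)$. Moreover, if $(X,\mu)$ satisfies the unit axiom (U), then $R(\mu)=R(\mu)'$.
   Context: A $\dagger$-category is a category with an identity-on-objects functor $\dagger:\mathcal{A}^{op}\to\mathcal{A}$ with $\dagger\circ\dagger=\mathrm{id}$. A $\dagger$-symmetric monoidal category is a symmetric monoidal category that is a $\dagger$-category, with $\dagger$ strict monoidal and all structure isomorphisms unitary ($\phi^{ -1}=\phi^\dagger$). It is monoidally well-pointed if for $f,g:X\otimes Y\to Z$, $f\circ(x\otimes y)=g\circ(x\otimes y)$ for all $x:I\to X$, $y:I\to Y$ implies $f=g$. Finite $\dagger$-biproducts: a zero object and binary biproducts whose coprojections $\kappa_i$ and projections $\pi_i$ satisfy $\kappa_i^\dagger=\pi_i$. Each hom-set carries a commutative monoid structure $f+g=\nabla\circ(f\oplus g)\circ\Delta$ with unit the zero morphism. Then $S=\mathrm{Hom}(I,I)$ is a commutative $*$-semiring (addition $+$, multiplication composition, involution $\dagger$), and $\mathrm{Hom}(X,X)$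 is an $S^*$-semialgebra: a semiring under $+$ and composition, with involution $\dagger$, and scalar multiplication $s\bullet f = X\cong X\otimes I\xrightarrow{f\otimes s}X\otimes I\cong X$, satisfying $s\bullet(m\circ n)=(s\bullet m)\circ n=m\circ(s\bullet n)$ and $(s\bullet m)^\dagger=s^\dagger\bullet m^\dagger$. For $B\subseteq\mathrm{Hom}(X,X)$, the commutant is $B'=\{f:X\to X\mid f\circ g=g\circ f\ \forall g\in B\}$. A commutative von Neumann $S^*$-semialgebra is a commutative unital $S^*$-subsemialgebra $\mathbf{A}$ of $\mathrm{Hom}(X,X)$ (a subset containing $0$ and $\mathrm{id}_X$ closed under $+$, composition, scalar multiplication and $\dagger$) with $\mathbf{A}=\mathbf{A}''$; it is maximal if it is not properly contained in any other commutative subsemialgebra (equivalently $\mathbf{A}=\mathbf{A}'$). An $H^*$-algebra (called a commutative $H^*$-algebra in the paper) is an object $X$ with $\mu:X\otimes X\to X$ such that: (A) $\mu\circ(\mu\otimes\mathrm{id})=\mu\circ(\mathrm{id}\otimes\mu)\circ a$ with $a$ the associator; (C) $\mu\circ\sigma_{X,X}=\mu$ with $\sigma$ the symmetry; (S) $\mu\circ\mu^\dagger=\mathrm{id}_X$; (H) for each point $x:I\to X$ there is a copoint $\tilde{x}:X\to I$ such that $\mu\circ(x\otimes\mathrm{id}_X)\circ\lambda_X^{ -1}=r_X\circ(\mathrm{id}_X\otimes\tilde{x})\circ\mu^\dagger$, with $r_X:X\otimes I\to X$ the right unitor (so in particular $R(\mu)$ is closed under $\dagger$). Axiom (U): there exists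 $\eta:I\to X$ with $\mu\circ(\eta\otimes\mathrm{id})\circ\lambda_X^{ -1}=\mathrm{id}_X=\mu\circ(\mathrm{id}\otimes\eta)\circ r_X^{ -1}$. -}

module Defs where

open import Level using (Level; _⊔_) renaming (suc to lsuc)
open import Relation.Binary.PropositionalEquality using (_≡_)
open import Relation.Unary using (Pred; _∈_; _⊆_; _≐_)
open import Data.Product using (Σ; ∃; _×_)

-- Hom-sets are types,
-- morphism equality is propositional equality.  Inverses of the structure
-- isomorphisms are given by their daggers (unitarity: φ⁻¹ = φ†).
record DaggerSMC (o ℓ : Level) : Set (lsuc (o ⊔ ℓ)) where
  infixr 9 _∘_
  infixr 10 _⊗₁_
  infixr 10 _⊗₀_
  infix 11 _†
  field
    Obj : Set o
    Hom : Obj → Obj → Set ℓ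
    id  : ∀ {A} → Hom A A
    _∘_ : ∀ {A B C} → Hom B C → Hom A B → Hom A C
    assoc     : ∀ {A B C D} {f : Hom A B} {g : Hom B C} {h : Hom C D} →
                (h ∘ g) ∘ f ≡ h ∘ (g ∘ f)
    identityˡ : ∀ {A B} {f : Hom A B} → id ∘ f ≡ f
    identityʳ : ∀ {A B} {f : Hom A B} → f ∘ id ≡ f
    _†      : ∀ {A B} → Hom A B → Hom B A
    †-id    : ∀ {A} → id {A} † ≡ id
    †-∘     : ∀ {A B C} {f : Hom A B} {g : Hom B C} → (g ∘ f) † ≡ f † ∘ g †
    †-invol : ∀ {A B} {f : Hom A B} → (f †) † ≡ f
    I    : Obj
    _⊗₀_ : Obj → Obj → Obj
    _⊗₁_ : ∀ {A B C D} → Hom A B → Hom C D → Hom (A ⊗₀ C) (B ⊗₀ D)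
    ⊗-id : ∀ {A B} → id {A} ⊗₁ id {B} ≡ id
    ⊗-∘  : ∀ {A B C D E F} {f : Hom A B} {g : Hom B C} {h : Hom D E} {k : Hom E F} →
           (g ∘ f) ⊗₁ (k ∘ h) ≡ (g ⊗₁ k) ∘ (f ⊗₁ h)
    α : ∀ {A B C} → Hom ((A ⊗₀ B) ⊗₀ C) (A ⊗₀ (B ⊗₀ C))
    λᵤ : ∀ {A} → Hom (I ⊗₀ A) A
    ρ  : ∀ {A} → Hom (A ⊗₀ I) A
    σ  : ∀ {A B} → Hom (A ⊗₀ B) (B ⊗₀ A)
    α-unitaryˡ : ∀ {A B C} → α {A} {B} {C} † ∘ α ≡ id
    α-unitaryʳ : ∀ {A B C} → α {A} {B} {C} ∘ α † ≡ id
    λ-unitaryˡ : ∀ {A} → λᵤ {A} † ∘ λᵤ ≡ id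
    λ-unitaryʳ : ∀ {A} → λᵤ {A} ∘ λᵤ † ≡ id
    ρ-unitaryˡ : ∀ {A} → ρ {A} † ∘ ρ ≡ id
    ρ-unitaryʳ : ∀ {A} → ρ {A} ∘ ρ † ≡ id
    σ-unitaryˡ : ∀ {A B} → σ {A} {B} † ∘ σ ≡ id
    σ-unitaryʳ : ∀ {A B} → σ {A} {B} ∘ σ † ≡ id
    α-natural : ∀ {A B C D E F} {f : Hom A B} {g : Hom C D} {h : Hom E F} →
                α ∘ ((f ⊗₁ g) ⊗₁ h) ≡ (f ⊗₁ (g ⊗₁ h)) ∘ α
    λ-natural : ∀ {A B} {f : Hom A B} → λᵤ ∘ (id {I} ⊗₁ f) ≡ f ∘ λᵤ
    ρ-natural : ∀ {A B} {f : Hom A B} → ρ ∘ (f ⊗₁ id {I}) ≡ f ∘ ρ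
    σ-natural : ∀ {A B C D} {f : Hom A B} {g : Hom C D} →
                σ ∘ (f ⊗₁ g) ≡ (g ⊗₁ f) ∘ σ
    pentagon : ∀ {A B C D} →
               (id {A} ⊗₁ α {B} {C} {D}) ∘ α {A} {B ⊗₀ C} {D} ∘ (α {A} {B} {C} ⊗₁ id {D})
               ≡ α {A} {B} {C ⊗₀ D} ∘ α {A ⊗₀ B} {C} {D}
    triangle : ∀ {A B} → (id {A} ⊗₁ λᵤ {B}) ∘ α {A} {I} {B} ≡ ρ {A} ⊗₁ id {B}
    hexagon  : ∀ {A B C} →
               α {B} {C} {A} ∘ σ {A} {B ⊗₀ C} ∘ α {A} {B} {C}
               ≡ (id {B} ⊗₁ σ {A} {C}) ∘ α {B} {A} {C} ∘ (σ {A} {B} ⊗₁ id {C})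
    σ-symmetric : ∀ {A B} → σ {B} {A} ∘ σ {A} {B} ≡ id
    †-⊗ : ∀ {A B C D} {f : Hom A B} {g : Hom C D} → (f ⊗₁ g) † ≡ (f †) ⊗₁ (g †)

module _ {o ℓ : Level} (𝒜 : DaggerSMC o ℓ) where
  open DaggerSMC 𝒜

  MonoidallyWellPointed : Set (o ⊔ ℓ)
  MonoidallyWellPointed =
    ∀ {X Y Z} (f g : Hom (X ⊗₀ Y) Z) →
    (∀ (x : Hom I X) (y : Hom I Y) → f ∘ (x ⊗₁ y) ≡ g ∘ (x ⊗₁ y)) → f ≡ g

  record DaggerBiproducts : Set (o ⊔ ℓ) where
    infixr 6 _⊕_
    field
      𝟘  : Obj
      !  : ∀ {A} → Hom A 𝟘
      ¡  : ∀ {A} → Hom 𝟘 A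
      !-unique : ∀ {A} (f : Hom A 𝟘) → f ≡ !
      ¡-unique : ∀ {A} (f : Hom 𝟘 A) → f ≡ ¡

    zeroMor : ∀ {A B} → Hom A B
    zeroMor = ¡ ∘ !

    field
      _⊕_ : Obj → Obj → Obj
      π₁ : ∀ {A B} → Hom (A ⊕ B) A
      π₂ : ∀ {A B} → Hom (A ⊕ B) B
      κ₁ : ∀ {A B} → Hom A (A ⊕ B)
      κ₂ : ∀ {A B} → Hom B (A ⊕ B)
      ⟨_,_⟩ : ∀ {A B C} → Hom C A → Hom C B → Hom C (A ⊕ B)
      π₁∘⟨⟩ : ∀ {A B C} {f : Hom C A} {g : Hom C B} → π₁ ∘ ⟨ f , g ⟩ ≡ f
      π₂∘⟨⟩ : ∀ {A B C} {f : Hom C A} {g : Hom C B} → π₂ ∘ ⟨ f , g ⟩ ≡ g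
      ⟨⟩-unique : ∀ {A B C} {f : Hom C A} {g : Hom C B} (h : Hom C (A ⊕ B)) →
                  π₁ ∘ h ≡ f → π₂ ∘ h ≡ g → h ≡ ⟨ f , g ⟩
      [_,_] : ∀ {A B C} → Hom A C → Hom B C → Hom (A ⊕ B) C
      []∘κ₁ : ∀ {A B C} {f : Hom A C} {g : Hom B C} → [ f , g ] ∘ κ₁ ≡ f
      []∘κ₂ : ∀ {A B C} {f : Hom A C} {g : Hom B C} → [ f , g ] ∘ κ₂ ≡ g
      []-unique : ∀ {A B C} {f : Hom A C} {g : Hom B C} (h : Hom (A ⊕ B) C) →
                  h ∘ κ₁ ≡ f → h ∘ κ₂ ≡ g → h ≡ [ f , g ]
      π₁∘κ₁ : ∀ {A B} → π₁ {A} {B} ∘ κ₁ ≡ id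
      π₂∘κ₂ : ∀ {A B} → π₂ {A} {B} ∘ κ₂ ≡ id
      π₂∘κ₁ : ∀ {A B} → π₂ {A} {B} ∘ κ₁ ≡ zeroMor
      π₁∘κ₂ : ∀ {A B} → π₁ {A} {B} ∘ κ₂ ≡ zeroMor
      κ₁-dagger : ∀ {A B} → κ₁ {A} {B} † ≡ π₁
      κ₂-dagger : ∀ {A B} → κ₂ {A} {B} † ≡ π₂

    _⊕₁_ : ∀ {A B C D} → Hom A B → Hom C D → Hom (A ⊕ C) (B ⊕ D)
    f ⊕₁ g = ⟨ f ∘ π₁ , g ∘ π₂ ⟩

    Δ : ∀ {A} → Hom A (A ⊕ A)
    Δ = ⟨ id , id ⟩

    ∇ : ∀ {A} → Hom (A ⊕ A) A
    ∇ = [ id , id ]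

    infixl 6 _+_
    _+_ : ∀ {A B} → Hom A B → Hom A B → Hom A B
    f + g = ∇ ∘ (f ⊕₁ g) ∘ Δ

  _•_ : ∀ {X} → Hom I I → Hom X X → Hom X X
  s • f = ρ ∘ (f ⊗₁ s) ∘ ρ †

  record HStarAlgebra (X : Obj) : Set ℓ where
    field
      μ     : Hom (X ⊗₀ X) X
      μ-assoc : μ ∘ (μ ⊗₁ id) ≡ μ ∘ (id ⊗₁ μ) ∘ α
      μ-comm  : μ ∘ σ ≡ μ
      μ-S     : μ ∘ μ † ≡ id
      μ-H     : ∀ (x : Hom I X) →
                Σ (Hom X I) (λ x̃ → μ ∘ (x ⊗₁ id) ∘ λᵤ † ≡ ρ ∘ (id ⊗₁ x̃) ∘ μ †)

  module _ {X : Obj} (H : HStarAlgebra X) where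
    open HStarAlgebra H

    Rpt : Hom I X → Hom X X
    Rpt x = μ ∘ (x ⊗₁ id) ∘ λᵤ †

    Rμ : Pred (Hom X X) ℓ
    Rμ f = ∃ λ (x : Hom I X) → f ≡ Rpt x

    UnitAxiom : Set ℓ
    UnitAxiom = Σ (Hom I X) λ η →
      (μ ∘ (η ⊗₁ id) ∘ λᵤ † ≡ id) × (μ ∘ (id ⊗₁ η) ∘ ρ † ≡ id)

  module _ {X : Obj} where
    Commutant : Pred (Hom X X) ℓ → Pred (Hom X X) ℓ
    Commutant B f = ∀ (g : Hom X X) → g ∈ B → f ∘ g ≡ g ∘ f

    module _ (Bp : DaggerBiproducts) where
      open DaggerBiproducts Bp

      record IsSubsemialgebra (𝐀 : Pred (Hom X X) ℓ) : Set ℓ where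
        field
          has-zero : zeroMor ∈ 𝐀
          has-id   : id ∈ 𝐀
          +-closed : ∀ {f g} → f ∈ 𝐀 → g ∈ 𝐀 → (f + g) ∈ 𝐀
          ∘-closed : ∀ {f g} → f ∈ 𝐀 → g ∈ 𝐀 → (f ∘ g) ∈ 𝐀
          •-closed : ∀ (s : Hom I I) {f} → f ∈ 𝐀 → (s • f) ∈ 𝐀
          †-closed : ∀ {f} → f ∈ 𝐀 → (f †) ∈ 𝐀

      IsCommutative : Pred (Hom X X) ℓ → Set ℓ
      IsCommutative 𝐀 = ∀ {f g} → f ∈ 𝐀 → g ∈ 𝐀 → f ∘ g ≡ g ∘ f

      IsCommSubsemialgebra : Pred (Hom X X) ℓ → Set ℓ
      IsCommSubsemialgebra 𝐀 = IsSubsemialgebra 𝐀 × IsCommutative 𝐀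

      IsCommVonNeumann : Pred (Hom X X) ℓ → Set ℓ
      IsCommVonNeumann 𝐀 = IsCommSubsemialgebra 𝐀 × (𝐀 ≐ Commutant (Commutant 𝐀))

      IsMaximalCommVonNeumann : Pred (Hom X X) ℓ → Set (lsuc ℓ)
      IsMaximalCommVonNeumann 𝐀 =
        IsCommVonNeumann 𝐀 ×
        (∀ (𝐁 : Pred (Hom X X) ℓ) → IsCommSubsemialgebra 𝐁 → 𝐀 ⊆ 𝐁 → 𝐁 ⊆ 𝐀)

module Submission where

-- For every B ⊆ Hom(X,X): B ⊆ B'', B' = B''',
--    B' is a unital subsemialgebra as soon as B is closed under †, and if B
--    is commutative (B ⊆ B') then every commutative 𝐁 ⊇ B' equals B'.
--    So B' is a maximal commutative von Neumann semialgebra whenever B is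
--    †-closed, B is commutative and B' is commutative.
-- 2. The H*-algebra.  Call f : X → X a module map if f ∘ μ = μ ∘ (id ⊗ f).
--    Associativity makes every R_x a module map; a module map commutes with
--    every R_x, and by monoidal well-pointedness every f ∈ R' is a module
--    map.  Using μ ∘ μ† = id, module maps f, g satisfy
--    f ∘ g = μ ∘ (f ⊗ g) ∘ μ†, which is symmetric in f, g by commutativity
--    of μ; hence R and R' are commutative.  Axiom (H) gives R_x† = R_y, so R
--    is †-closed; under (U) a module map f equals R_{f ∘ η}, so R' ⊆ R.

open import Defs
open import Level using (Level)
open import Data.Product using (_×_; _,_; proj₁; proj₂)
open import Relation.Unary using (Pred; _∈_; _⊆_; _≐_)
open import Relation.Binary.PropositionalEquality
  using (_≡_; refl; sym; trans; cong; cong₂; module ≡-Reasoning)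

module MonoidalReasoning {o ℓ : Level} (𝒜 : DaggerSMC o ℓ) where
  open DaggerSMC 𝒜
  open ≡-Reasoning

  pullˡ : ∀ {A B C D} {a : Hom C D} {b : Hom B C} {c : Hom B D} {f : Hom A B} →
          a ∘ b ≡ c → a ∘ b ∘ f ≡ c ∘ f
  pullˡ e = trans (sym assoc) (cong (_∘ _) e)

  cancel-splitEpi : ∀ {A B C} {f g : Hom B C} {u : Hom A B} {v : Hom B A} →
                    u ∘ v ≡ id → f ∘ u ≡ g ∘ u → f ≡ g
  cancel-splitEpi {f = f} {g} {u} {v} uv e = begin
    f             ≡⟨ sym identityʳ ⟩
    f ∘ id        ≡⟨ cong (f ∘_) (sym uv) ⟩
    f ∘ u ∘ v     ≡⟨ pullˡ e ⟩
    (g ∘ u) ∘ v   ≡⟨ assoc ⟩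
    g ∘ u ∘ v     ≡⟨ cong (g ∘_) uv ⟩
    g ∘ id        ≡⟨ identityʳ ⟩
    g             ∎

  cancel-splitMono : ∀ {A B C} {f g : Hom A B} {u : Hom B C} {v : Hom C B} →
                     v ∘ u ≡ id → u ∘ f ≡ u ∘ g → f ≡ g
  cancel-splitMono {f = f} {g} {u} {v} vu e = begin
    f             ≡⟨ sym identityˡ ⟩
    id ∘ f        ≡⟨ cong (_∘ f) (sym vu) ⟩
    (v ∘ u) ∘ f   ≡⟨ assoc ⟩
    v ∘ u ∘ f     ≡⟨ cong (v ∘_) e ⟩
    v ∘ u ∘ g     ≡⟨ pullˡ vu ⟩
    id ∘ g        ≡⟨ identityˡ ⟩
    g             ∎

  inverse-natural : ∀ {P Q A B} {u₁ : Hom P A} {v₁ : Hom A P} {u₂ : Hom Q B}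
                    {v₂ : Hom B Q} {F : Hom P Q} {f : Hom A B} →
                    u₁ ∘ v₁ ≡ id → v₂ ∘ u₂ ≡ id → u₂ ∘ F ≡ f ∘ u₁ →
                    v₂ ∘ f ≡ F ∘ v₁
  inverse-natural {u₁ = u₁} {v₁} {u₂} {v₂} {F} {f} uv vu e = begin
    v₂ ∘ f              ≡⟨ cong (v₂ ∘_) (sym identityʳ) ⟩
    v₂ ∘ f ∘ id         ≡⟨ cong (λ h → v₂ ∘ f ∘ h) (sym uv) ⟩
    v₂ ∘ f ∘ u₁ ∘ v₁    ≡⟨ cong (v₂ ∘_) (pullˡ (sym e)) ⟩
    v₂ ∘ (u₂ ∘ F) ∘ v₁  ≡⟨ cong (v₂ ∘_) assoc ⟩
    v₂ ∘ u₂ ∘ F ∘ v₁    ≡⟨ pullˡ vu ⟩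
    id ∘ F ∘ v₁         ≡⟨ identityˡ ⟩
    F ∘ v₁              ∎

  λ†-natural : ∀ {A B} {f : Hom A B} → λᵤ † ∘ f ≡ (id ⊗₁ f) ∘ λᵤ †
  λ†-natural = inverse-natural λ-unitaryʳ λ-unitaryˡ λ-natural

  ρ†-natural : ∀ {A B} {f : Hom A B} → ρ † ∘ f ≡ (f ⊗₁ id) ∘ ρ †
  ρ†-natural = inverse-natural ρ-unitaryʳ ρ-unitaryˡ ρ-natural

  α†-natural : ∀ {A B C D E F} {f : Hom A B} {g : Hom C D} {h : Hom E F} →
               α † ∘ (f ⊗₁ (g ⊗₁ h)) ≡ ((f ⊗₁ g) ⊗₁ h) ∘ α †
  α†-natural = inverse-natural α-unitaryʳ α-unitaryˡ α-natural

  id⊗-∘ : ∀ {A B C D} {f : Hom B C} {g : Hom C D} →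
          id {A} ⊗₁ (g ∘ f) ≡ (id ⊗₁ g) ∘ (id ⊗₁ f)
  id⊗-∘ {g = g} = trans (cong (_⊗₁ _) (sym identityˡ)) ⊗-∘

  ∘-⊗id : ∀ {A B C D} {f : Hom B C} {g : Hom C D} →
          (g ∘ f) ⊗₁ id {A} ≡ (g ⊗₁ id) ∘ (f ⊗₁ id)
  ∘-⊗id = trans (cong (_ ⊗₁_) (sym identityˡ)) ⊗-∘

  interchangeˡ : ∀ {A B C D} {f : Hom A B} {g : Hom C D} →
                 (f ⊗₁ id) ∘ (id ⊗₁ g) ≡ f ⊗₁ g
  interchangeˡ = trans (sym ⊗-∘) (cong₂ _⊗₁_ identityʳ identityˡ)

  interchangeʳ : ∀ {A B C D} {f : Hom A B} {g : Hom C D} →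
                 (id ⊗₁ g) ∘ (f ⊗₁ id) ≡ f ⊗₁ g
  interchangeʳ = trans (sym ⊗-∘) (cong₂ _⊗₁_ identityˡ identityʳ)

  -- Tensoring with id_I on either side is faithful (the unitors are isos).
  I⊗-faithful : ∀ {A B} {f g : Hom A B} → id {I} ⊗₁ f ≡ id ⊗₁ g → f ≡ g
  I⊗-faithful e = cancel-splitEpi λ-unitaryʳ
    (trans (sym λ-natural) (trans (cong (λᵤ ∘_) e) λ-natural))

  ⊗I-faithful : ∀ {A B} {f g : Hom A B} → f ⊗₁ id {I} ≡ g ⊗₁ id → f ≡ g
  ⊗I-faithful e = cancel-splitEpi ρ-unitaryʳ
    (trans (sym ρ-natural) (trans (cong (ρ ∘_) e) ρ-natural))

  †-id⊗ : ∀ {A B C} {f : Hom B C} → (id {A} ⊗₁ f) † ≡ id ⊗₁ f †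
  †-id⊗ = trans †-⊗ (cong (_⊗₁ _) †-id)

  †-⊗id : ∀ {A B C} {f : Hom B C} → (f ⊗₁ id {A}) † ≡ f † ⊗₁ id
  †-⊗id = trans †-⊗ (cong (_ ⊗₁_) †-id)

  -- Kelly's coherence lemma λ_{C⊗D} ∘ α = λ_C ⊗ id: whiskered by id_I and
  -- precomposed with the iso α ∘ (α ⊗ id), both sides reduce via the
  -- pentagon and the triangle to α ∘ ((ρ ⊗ id) ⊗ id).
  λ-α : ∀ {C D} → λᵤ {C ⊗₀ D} ∘ α {I} {C} {D} ≡ λᵤ ⊗₁ id {D}
  λ-α {C} {D} = I⊗-faithful (cancel-splitEpi pentagon-iso (begin
    (id ⊗₁ (λᵤ ∘ α)) ∘ α ∘ (α ⊗₁ id)          ≡⟨ cong (_∘ (α ∘ (α ⊗₁ id))) id⊗-∘ ⟩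
    ((id ⊗₁ λᵤ) ∘ (id ⊗₁ α)) ∘ α ∘ (α ⊗₁ id)  ≡⟨ assoc ⟩
    (id ⊗₁ λᵤ) ∘ (id ⊗₁ α) ∘ α ∘ (α ⊗₁ id)    ≡⟨ cong ((id ⊗₁ λᵤ) ∘_) pentagon ⟩
    (id ⊗₁ λᵤ) ∘ α ∘ α                        ≡⟨ pullˡ triangle ⟩
    (ρ ⊗₁ id) ∘ α                             ≡⟨ cong (λ h → (ρ ⊗₁ h) ∘ α) (sym ⊗-id) ⟩
    (ρ ⊗₁ (id ⊗₁ id)) ∘ α                     ≡⟨ sym α-natural ⟩
    α ∘ ((ρ ⊗₁ id) ⊗₁ id)                     ≡⟨ cong (λ h → α ∘ (h ⊗₁ id)) (sym triangle) ⟩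
    α ∘ (((id ⊗₁ λᵤ) ∘ α) ⊗₁ id)              ≡⟨ cong (α ∘_) ∘-⊗id ⟩
    α ∘ ((id ⊗₁ λᵤ) ⊗₁ id) ∘ (α ⊗₁ id)        ≡⟨ pullˡ α-natural ⟩
    ((id ⊗₁ (λᵤ ⊗₁ id)) ∘ α) ∘ (α ⊗₁ id)      ≡⟨ assoc ⟩
    (id ⊗₁ (λᵤ ⊗₁ id)) ∘ α ∘ (α ⊗₁ id)        ∎))
    where
    pentagon-iso : (α {I} {I ⊗₀ C} {D} ∘ (α {I} {I} {C} ⊗₁ id)) ∘ (α † ⊗₁ id) ∘ α † ≡ id
    pentagon-iso = begin
      (α ∘ (α ⊗₁ id)) ∘ (α † ⊗₁ id) ∘ α †  ≡⟨ assoc ⟩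
      α ∘ (α ⊗₁ id) ∘ (α † ⊗₁ id) ∘ α †    ≡⟨ cong (α ∘_) (pullˡ (sym ∘-⊗id)) ⟩
      α ∘ ((α ∘ α †) ⊗₁ id) ∘ α †          ≡⟨ cong (λ h → α ∘ (h ⊗₁ id) ∘ α †) α-unitaryʳ ⟩
      α ∘ (id ⊗₁ id) ∘ α †                 ≡⟨ cong (λ h → α ∘ h ∘ α †) ⊗-id ⟩
      α ∘ id ∘ α †                         ≡⟨ cong (α ∘_) identityˡ ⟩
      α ∘ α †                              ≡⟨ α-unitaryʳ ⟩
      id                                   ∎

  -- Kelly's coherence lemma λ ∘ σ = ρ, from the triangle, the hexagon and λ-α.
  λ-σ : ∀ {A} → λᵤ {A} ∘ σ {A} {I} ≡ ρ
  λ-σ = sym (⊗I-faithful (cancel-splitMono σ-unitaryˡ (begin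
    σ ∘ (ρ ⊗₁ id)                       ≡⟨ cong (σ ∘_) (sym triangle) ⟩
    σ ∘ (id ⊗₁ λᵤ) ∘ α                  ≡⟨ pullˡ σ-natural ⟩
    ((λᵤ ⊗₁ id) ∘ σ) ∘ α                ≡⟨ assoc ⟩
    (λᵤ ⊗₁ id) ∘ σ ∘ α                  ≡⟨ cong (_∘ (σ ∘ α)) (sym λ-α) ⟩
    (λᵤ ∘ α) ∘ σ ∘ α                    ≡⟨ assoc ⟩
    λᵤ ∘ α ∘ σ ∘ α                      ≡⟨ cong (λᵤ ∘_) hexagon ⟩
    λᵤ ∘ (id ⊗₁ σ) ∘ α ∘ (σ ⊗₁ id)      ≡⟨ pullˡ λ-natural ⟩
    (σ ∘ λᵤ) ∘ α ∘ (σ ⊗₁ id)            ≡⟨ assoc ⟩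
    σ ∘ λᵤ ∘ α ∘ (σ ⊗₁ id)              ≡⟨ cong (σ ∘_) (pullˡ λ-α) ⟩
    σ ∘ (λᵤ ⊗₁ id) ∘ (σ ⊗₁ id)          ≡⟨ cong (σ ∘_) (sym ∘-⊗id) ⟩
    σ ∘ ((λᵤ ∘ σ) ⊗₁ id)                ∎)))

  α†-λ† : ∀ {A B} → α {I} {A} {B} † ∘ λᵤ † ≡ λᵤ † ⊗₁ id
  α†-λ† = trans (sym †-∘) (trans (cong _† λ-α) †-⊗id)

  σ-ρ† : ∀ {A} → σ {A} {I} ∘ ρ † ≡ λᵤ †
  σ-ρ† = begin
    σ ∘ ρ †            ≡⟨ cong (λ h → σ ∘ h †) (sym λ-σ) ⟩
    σ ∘ (λᵤ ∘ σ) †     ≡⟨ cong (σ ∘_) †-∘ ⟩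
    σ ∘ σ † ∘ λᵤ †     ≡⟨ pullˡ σ-unitaryʳ ⟩
    id ∘ λᵤ †          ≡⟨ identityˡ ⟩
    λᵤ †               ∎

  -- Placing a point y : I → B beside an object A: A ≅ I ⊗ A → B ⊗ A, so
  -- that R_y = μ ∘ placeˡ y.  Its naturality, associativity and behaviour
  -- on points are what the H*-algebra arguments use.
  placeˡ : ∀ {A B} → Hom I B → Hom A (B ⊗₀ A)
  placeˡ y = (y ⊗₁ id) ∘ λᵤ †

  placeˡ-natural : ∀ {A B C} {y : Hom I C} {f : Hom A B} →
                   placeˡ y ∘ f ≡ (id ⊗₁ f) ∘ placeˡ y
  placeˡ-natural {y = y} {f} = begin
    ((y ⊗₁ id) ∘ λᵤ †) ∘ f      ≡⟨ assoc ⟩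
    (y ⊗₁ id) ∘ λᵤ † ∘ f        ≡⟨ cong ((y ⊗₁ id) ∘_) λ†-natural ⟩
    (y ⊗₁ id) ∘ (id ⊗₁ f) ∘ λᵤ † ≡⟨ pullˡ (trans interchangeˡ (sym interchangeʳ)) ⟩
    ((id ⊗₁ f) ∘ (y ⊗₁ id)) ∘ λᵤ † ≡⟨ assoc ⟩
    (id ⊗₁ f) ∘ (y ⊗₁ id) ∘ λᵤ †  ∎

  placeˡ-assoc : ∀ {A B C} {y : Hom I C} →
                 α † ∘ placeˡ {A ⊗₀ B} y ≡ placeˡ y ⊗₁ id
  placeˡ-assoc {y = y} = begin
    α † ∘ (y ⊗₁ id) ∘ λᵤ †                   ≡⟨ cong (λ h → α † ∘ (y ⊗₁ h) ∘ λᵤ †) (sym ⊗-id) ⟩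
    α † ∘ (y ⊗₁ (id ⊗₁ id)) ∘ λᵤ †           ≡⟨ pullˡ α†-natural ⟩
    (((y ⊗₁ id) ⊗₁ id) ∘ α †) ∘ λᵤ †         ≡⟨ assoc ⟩
    ((y ⊗₁ id) ⊗₁ id) ∘ α † ∘ λᵤ †           ≡⟨ cong (((y ⊗₁ id) ⊗₁ id) ∘_) α†-λ† ⟩
    ((y ⊗₁ id) ⊗₁ id) ∘ (λᵤ † ⊗₁ id)         ≡⟨ sym ∘-⊗id ⟩
    ((y ⊗₁ id) ∘ λᵤ †) ⊗₁ id                 ∎

  placeˡ-point : ∀ {A B} {x : Hom I A} {y : Hom I B} → placeˡ x ∘ y ∘ λᵤ ≡ x ⊗₁ y
  placeˡ-point {x = x} {y} = begin
    placeˡ x ∘ y ∘ λᵤ               ≡⟨ pullˡ placeˡ-natural ⟩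
    ((id ⊗₁ y) ∘ placeˡ x) ∘ λᵤ     ≡⟨ assoc ⟩
    (id ⊗₁ y) ∘ placeˡ x ∘ λᵤ       ≡⟨ cong ((id ⊗₁ y) ∘_) assoc ⟩
    (id ⊗₁ y) ∘ (x ⊗₁ id) ∘ λᵤ † ∘ λᵤ ≡⟨ cong (λ h → (id ⊗₁ y) ∘ (x ⊗₁ id) ∘ h) λ-unitaryˡ ⟩
    (id ⊗₁ y) ∘ (x ⊗₁ id) ∘ id      ≡⟨ cong ((id ⊗₁ y) ∘_) identityʳ ⟩
    (id ⊗₁ y) ∘ (x ⊗₁ id)           ≡⟨ interchangeʳ ⟩
    x ⊗₁ y                          ∎

  σ-placeʳ : ∀ {A B} {y : Hom I B} → σ ∘ (id {A} ⊗₁ y) ∘ ρ † ≡ placeˡ y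
  σ-placeʳ {y = y} = begin
    σ ∘ (id ⊗₁ y) ∘ ρ †      ≡⟨ pullˡ σ-natural ⟩
    ((y ⊗₁ id) ∘ σ) ∘ ρ †    ≡⟨ assoc ⟩
    (y ⊗₁ id) ∘ σ ∘ ρ †      ≡⟨ cong ((y ⊗₁ id) ∘_) σ-ρ† ⟩
    (y ⊗₁ id) ∘ λᵤ †         ∎

module BiproductAddition {o ℓ : Level} (𝒜 : DaggerSMC o ℓ)
                         (Bp : DaggerBiproducts 𝒜) where
  open DaggerSMC 𝒜
  open DaggerBiproducts Bp
  open MonoidalReasoning 𝒜
  open ≡-Reasoning

  -- Zero morphisms factor through the zero object, hence absorb composition.
  zeroMor-absorbˡ : ∀ {A B C} {h : Hom B C} → h ∘ zeroMor {A} {B} ≡ zeroMor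
  zeroMor-absorbˡ {h = h} = pullˡ (¡-unique (h ∘ ¡))

  zeroMor-absorbʳ : ∀ {A B C} {h : Hom A B} → zeroMor {B} {C} ∘ h ≡ zeroMor
  zeroMor-absorbʳ {h = h} = trans assoc (cong (¡ ∘_) (!-unique (! ∘ h)))

  π-jointlyMonic : ∀ {A B C} {h k : Hom C (A ⊕ B)} →
                   π₁ ∘ h ≡ π₁ ∘ k → π₂ ∘ h ≡ π₂ ∘ k → h ≡ k
  π-jointlyMonic {h = h} {k} e₁ e₂ = trans (⟨⟩-unique h e₁ e₂) (sym (⟨⟩-unique k refl refl))

  κ-jointlyEpic : ∀ {A B C} {h k : Hom (A ⊕ B) C} →
                  h ∘ κ₁ ≡ k ∘ κ₁ → h ∘ κ₂ ≡ k ∘ κ₂ → h ≡ k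
  κ-jointlyEpic {h = h} {k} e₁ e₂ = trans ([]-unique h e₁ e₂) (sym ([]-unique k refl refl))

  ⟨⟩-∘ : ∀ {A B C D} {f : Hom C A} {g : Hom C B} {h : Hom D C} →
         ⟨ f , g ⟩ ∘ h ≡ ⟨ f ∘ h , g ∘ h ⟩
  ⟨⟩-∘ = ⟨⟩-unique _ (pullˡ π₁∘⟨⟩) (pullˡ π₂∘⟨⟩)

  ∘-[] : ∀ {A B C D} {f : Hom A C} {g : Hom B C} {h : Hom C D} →
         h ∘ [ f , g ] ≡ [ h ∘ f , h ∘ g ]
  ∘-[] {h = h} = []-unique _ (trans assoc (cong (h ∘_) []∘κ₁))
                            (trans assoc (cong (h ∘_) []∘κ₂))

  -- f ⊕ g acts componentwise on the coprojections; the off-diagonal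
  -- components vanish because π₂ ∘ κ₁ and π₁ ∘ κ₂ are zero.
  ⊕₁-κ₁ : ∀ {A B C D} {f : Hom A B} {g : Hom C D} → (f ⊕₁ g) ∘ κ₁ ≡ κ₁ ∘ f
  ⊕₁-κ₁ {f = f} {g} = π-jointlyMonic on-first on-second
    where
    on-first : π₁ ∘ (f ⊕₁ g) ∘ κ₁ ≡ π₁ ∘ κ₁ ∘ f
    on-first = begin
      π₁ ∘ (f ⊕₁ g) ∘ κ₁  ≡⟨ pullˡ π₁∘⟨⟩ ⟩
      (f ∘ π₁) ∘ κ₁       ≡⟨ trans assoc (cong (f ∘_) π₁∘κ₁) ⟩
      f ∘ id              ≡⟨ trans identityʳ (sym identityˡ) ⟩
      id ∘ f              ≡⟨ sym (pullˡ π₁∘κ₁) ⟩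
      π₁ ∘ κ₁ ∘ f         ∎
    on-second : π₂ ∘ (f ⊕₁ g) ∘ κ₁ ≡ π₂ ∘ κ₁ ∘ f
    on-second = begin
      π₂ ∘ (f ⊕₁ g) ∘ κ₁  ≡⟨ pullˡ π₂∘⟨⟩ ⟩
      (g ∘ π₂) ∘ κ₁       ≡⟨ trans assoc (cong (g ∘_) π₂∘κ₁) ⟩
      g ∘ zeroMor         ≡⟨ trans zeroMor-absorbˡ (sym zeroMor-absorbʳ) ⟩
      zeroMor ∘ f         ≡⟨ sym (pullˡ π₂∘κ₁) ⟩
      π₂ ∘ κ₁ ∘ f         ∎

  ⊕₁-κ₂ : ∀ {A B C D} {f : Hom A B} {g : Hom C D} → (f ⊕₁ g) ∘ κ₂ ≡ κ₂ ∘ g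
  ⊕₁-κ₂ {f = f} {g} = π-jointlyMonic on-first on-second
    where
    on-first : π₁ ∘ (f ⊕₁ g) ∘ κ₂ ≡ π₁ ∘ κ₂ ∘ g
    on-first = begin
      π₁ ∘ (f ⊕₁ g) ∘ κ₂  ≡⟨ pullˡ π₁∘⟨⟩ ⟩
      (f ∘ π₁) ∘ κ₂       ≡⟨ trans assoc (cong (f ∘_) π₁∘κ₂) ⟩
      f ∘ zeroMor         ≡⟨ trans zeroMor-absorbˡ (sym zeroMor-absorbʳ) ⟩
      zeroMor ∘ g         ≡⟨ sym (pullˡ π₁∘κ₂) ⟩
      π₁ ∘ κ₂ ∘ g         ∎
    on-second : π₂ ∘ (f ⊕₁ g) ∘ κ₂ ≡ π₂ ∘ κ₂ ∘ g
    on-second = begin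
      π₂ ∘ (f ⊕₁ g) ∘ κ₂  ≡⟨ pullˡ π₂∘⟨⟩ ⟩
      (g ∘ π₂) ∘ κ₂       ≡⟨ trans assoc (cong (g ∘_) π₂∘κ₂) ⟩
      g ∘ id              ≡⟨ trans identityʳ (sym identityˡ) ⟩
      id ∘ g              ≡⟨ sym (pullˡ π₂∘κ₂) ⟩
      π₂ ∘ κ₂ ∘ g         ∎

  ∇-⊕₁ : ∀ {A B C} {f : Hom A C} {g : Hom B C} → ∇ ∘ (f ⊕₁ g) ≡ [ f , g ]
  ∇-⊕₁ {f = f} {g} = κ-jointlyEpic
    (begin
      (∇ ∘ (f ⊕₁ g)) ∘ κ₁   ≡⟨ trans assoc (cong (∇ ∘_) ⊕₁-κ₁) ⟩
      ∇ ∘ κ₁ ∘ f            ≡⟨ trans (pullˡ []∘κ₁) identityˡ ⟩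
      f                     ≡⟨ sym []∘κ₁ ⟩
      [ f , g ] ∘ κ₁        ∎)
    (begin
      (∇ ∘ (f ⊕₁ g)) ∘ κ₂   ≡⟨ trans assoc (cong (∇ ∘_) ⊕₁-κ₂) ⟩
      ∇ ∘ κ₂ ∘ g            ≡⟨ trans (pullˡ []∘κ₂) identityˡ ⟩
      g                     ≡⟨ sym []∘κ₂ ⟩
      [ f , g ] ∘ κ₂        ∎)

  +-pairing : ∀ {A B} {f g : Hom A B} → f + g ≡ ∇ ∘ ⟨ f , g ⟩
  +-pairing {f = f} {g} = cong (∇ ∘_) (begin
    ⟨ f ∘ π₁ , g ∘ π₂ ⟩ ∘ Δ          ≡⟨ ⟨⟩-∘ ⟩
    ⟨ (f ∘ π₁) ∘ Δ , (g ∘ π₂) ∘ Δ ⟩  ≡⟨ cong₂ ⟨_,_⟩ (trans assoc (cong (f ∘_) π₁∘⟨⟩))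
                                                    (trans assoc (cong (g ∘_) π₂∘⟨⟩)) ⟩
    ⟨ f ∘ id , g ∘ id ⟩              ≡⟨ cong₂ ⟨_,_⟩ identityʳ identityʳ ⟩
    ⟨ f , g ⟩                        ∎)

  +-copairing : ∀ {A B} {f g : Hom A B} → f + g ≡ [ f , g ] ∘ Δ
  +-copairing = pullˡ ∇-⊕₁

  ∘-distribʳ-+ : ∀ {A B C} {f g : Hom B C} {h : Hom A B} → (f + g) ∘ h ≡ f ∘ h + g ∘ h
  ∘-distribʳ-+ {f = f} {g} {h} = begin
    (f + g) ∘ h               ≡⟨ cong (_∘ h) +-pairing ⟩
    (∇ ∘ ⟨ f , g ⟩) ∘ h       ≡⟨ trans assoc (cong (∇ ∘_) ⟨⟩-∘) ⟩
    ∇ ∘ ⟨ f ∘ h , g ∘ h ⟩     ≡⟨ sym +-pairing ⟩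
    f ∘ h + g ∘ h             ∎

  ∘-distribˡ-+ : ∀ {A B C} {f g : Hom A B} {h : Hom B C} → h ∘ (f + g) ≡ h ∘ f + h ∘ g
  ∘-distribˡ-+ {f = f} {g} {h} = begin
    h ∘ (f + g)               ≡⟨ cong (h ∘_) +-copairing ⟩
    h ∘ [ f , g ] ∘ Δ         ≡⟨ pullˡ ∘-[] ⟩
    [ h ∘ f , h ∘ g ] ∘ Δ     ≡⟨ sym +-copairing ⟩
    h ∘ f + h ∘ g             ∎

module ScalarMultiplication {o ℓ : Level} (𝒜 : DaggerSMC o ℓ) where
  open DaggerSMC 𝒜
  open MonoidalReasoning 𝒜
  open ≡-Reasoning

  scale : ∀ {X} → Hom I I → Hom X X → Hom X X
  scale = _•_ 𝒜

  scale-∘ʳ : ∀ {X} (s : Hom I I) {f g : Hom X X} → scale s f ∘ g ≡ scale s (f ∘ g)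
  scale-∘ʳ s {f} {g} = begin
    (ρ ∘ (f ⊗₁ s) ∘ ρ †) ∘ g              ≡⟨ trans assoc (cong (ρ ∘_) assoc) ⟩
    ρ ∘ (f ⊗₁ s) ∘ ρ † ∘ g                ≡⟨ cong (λ h → ρ ∘ (f ⊗₁ s) ∘ h) ρ†-natural ⟩
    ρ ∘ (f ⊗₁ s) ∘ (g ⊗₁ id) ∘ ρ †        ≡⟨ cong (ρ ∘_) (pullˡ (sym ⊗-∘)) ⟩
    ρ ∘ ((f ∘ g) ⊗₁ (s ∘ id)) ∘ ρ †       ≡⟨ cong (λ h → ρ ∘ ((f ∘ g) ⊗₁ h) ∘ ρ †) identityʳ ⟩
    ρ ∘ ((f ∘ g) ⊗₁ s) ∘ ρ †              ∎

  scale-∘ˡ : ∀ {X} (s : Hom I I) {f g : Hom X X} → g ∘ scale s f ≡ scale s (g ∘ f)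
  scale-∘ˡ s {f} {g} = begin
    g ∘ ρ ∘ (f ⊗₁ s) ∘ ρ †                ≡⟨ pullˡ (sym ρ-natural) ⟩
    (ρ ∘ (g ⊗₁ id)) ∘ (f ⊗₁ s) ∘ ρ †      ≡⟨ trans assoc (cong (ρ ∘_) (pullˡ (sym ⊗-∘))) ⟩
    ρ ∘ ((g ∘ f) ⊗₁ (id ∘ s)) ∘ ρ †       ≡⟨ cong (λ h → ρ ∘ ((g ∘ f) ⊗₁ h) ∘ ρ †) identityˡ ⟩
    ρ ∘ ((g ∘ f) ⊗₁ s) ∘ ρ †              ∎

module Commutants {o ℓ : Level} (𝒜 : DaggerSMC o ℓ) {X : DaggerSMC.Obj 𝒜} where
  open DaggerSMC 𝒜
  open ≡-Reasoning

  _′ : Pred (Hom X X) ℓ → Pred (Hom X X) ℓ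
  _′ = Commutant 𝒜

  commutant-antitone : ∀ {B C : Pred (Hom X X) ℓ} → B ⊆ C → (C ′) ⊆ (B ′)
  commutant-antitone B⊆C f∈C′ g g∈B = f∈C′ g (B⊆C g∈B)

  ⊆-bicommutant : ∀ {B : Pred (Hom X X) ℓ} → B ⊆ ((B ′) ′)
  ⊆-bicommutant f∈B g g∈B′ = sym (g∈B′ _ f∈B)

  commutant-vonNeumann : ∀ {B : Pred (Hom X X) ℓ} → (B ′) ≐ (((B ′) ′) ′)
  commutant-vonNeumann = ⊆-bicommutant , commutant-antitone ⊆-bicommutant

  commutant-†-closed : ∀ {B : Pred (Hom X X) ℓ} → (∀ {g} → g ∈ B → g † ∈ B) →
                       ∀ {f} → f ∈ (B ′) → f † ∈ (B ′)
  commutant-†-closed †-closed {f} f∈B′ g g∈B = begin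
    f † ∘ g         ≡⟨ cong (f † ∘_) (sym †-invol) ⟩
    f † ∘ g † †     ≡⟨ sym †-∘ ⟩
    (g † ∘ f) †     ≡⟨ cong _† (sym (f∈B′ (g †) (†-closed g∈B))) ⟩
    (f ∘ g †) †     ≡⟨ †-∘ ⟩
    g † † ∘ f †     ≡⟨ cong (_∘ f †) †-invol ⟩
    g ∘ f †         ∎

  module _ (Bp : DaggerBiproducts 𝒜) where
    open DaggerBiproducts Bp
    open BiproductAddition 𝒜 Bp
    open ScalarMultiplication 𝒜

    commutant-subsemialgebra : ∀ {B : Pred (Hom X X) ℓ} →
                               (∀ {g} → g ∈ B → g † ∈ B) →
                               IsSubsemialgebra 𝒜 Bp (B ′)
    commutant-subsemialgebra †-closed = record
      { has-zero = λ g _ → trans zeroMor-absorbʳ (sym zeroMor-absorbˡ)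
      ; has-id   = λ g _ → trans identityˡ (sym identityʳ)
      ; +-closed = λ {f} {g} f∈B′ g∈B′ h h∈B → begin
          (f + g) ∘ h       ≡⟨ ∘-distribʳ-+ ⟩
          f ∘ h + g ∘ h     ≡⟨ cong₂ _+_ (f∈B′ h h∈B) (g∈B′ h h∈B) ⟩
          h ∘ f + h ∘ g     ≡⟨ sym ∘-distribˡ-+ ⟩
          h ∘ (f + g)       ∎
      ; ∘-closed = λ {f} {g} f∈B′ g∈B′ h h∈B → begin
          (f ∘ g) ∘ h       ≡⟨ trans assoc (cong (f ∘_) (g∈B′ h h∈B)) ⟩
          f ∘ h ∘ g         ≡⟨ trans (sym assoc) (cong (_∘ g) (f∈B′ h h∈B)) ⟩
          (h ∘ f) ∘ g       ≡⟨ assoc ⟩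
          h ∘ f ∘ g         ∎
      ; •-closed = λ s {f} f∈B′ h h∈B → begin
          scale s f ∘ h     ≡⟨ scale-∘ʳ s ⟩
          scale s (f ∘ h)   ≡⟨ cong (scale s) (f∈B′ h h∈B) ⟩
          scale s (h ∘ f)   ≡⟨ sym (scale-∘ˡ s) ⟩
          h ∘ scale s f     ∎
      ; †-closed = commutant-†-closed †-closed
      }

    commutant-maximal : ∀ {B : Pred (Hom X X) ℓ} → B ⊆ (B ′) →
                        ∀ (𝐁 : Pred (Hom X X) ℓ) → IsCommutative 𝒜 Bp 𝐁 →
                        (B ′) ⊆ 𝐁 → 𝐁 ⊆ (B ′)
    commutant-maximal B⊆B′ 𝐁 𝐁-comm B′⊆𝐁 f∈𝐁 g g∈B = 𝐁-comm f∈𝐁 (B′⊆𝐁 (B⊆B′ g∈B))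

    commutant-maximalVonNeumann : ∀ {B : Pred (Hom X X) ℓ} →
                                  (∀ {g} → g ∈ B → g † ∈ B) → B ⊆ (B ′) →
                                  IsCommutative 𝒜 Bp (B ′) →
                                  IsMaximalCommVonNeumann 𝒜 Bp (B ′)
    commutant-maximalVonNeumann †-closed B⊆B′ B′-comm =
      ((commutant-subsemialgebra †-closed , B′-comm) , commutant-vonNeumann)
      , λ 𝐁 (_ , 𝐁-comm) → commutant-maximal B⊆B′ 𝐁 𝐁-comm

module HStarAlgebraProperties {o ℓ : Level} (𝒜 : DaggerSMC o ℓ)
                              {X : DaggerSMC.Obj 𝒜} (H : HStarAlgebra 𝒜 X) where
  open DaggerSMC 𝒜
  open HStarAlgebra H
  open MonoidalReasoning 𝒜
  open ≡-Reasoning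

  R : Pred (Hom X X) ℓ
  R = Rμ 𝒜 H

  Rₓ : Hom I X → Hom X X
  Rₓ = Rpt 𝒜 H

  IsModuleMap : Hom X X → Set ℓ
  IsModuleMap f = f ∘ μ ≡ μ ∘ (id ⊗₁ f)

  μ-twist : ∀ {f g : Hom X X} → μ ∘ (f ⊗₁ g) ≡ μ ∘ (g ⊗₁ f) ∘ σ
  μ-twist {f} {g} = begin
    μ ∘ (f ⊗₁ g)          ≡⟨ cong (_∘ (f ⊗₁ g)) (sym μ-comm) ⟩
    (μ ∘ σ) ∘ (f ⊗₁ g)    ≡⟨ trans assoc (cong (μ ∘_) σ-natural) ⟩
    μ ∘ (g ⊗₁ f) ∘ σ      ∎

  factors-swap : ∀ {f g h : Hom X X} → f ∘ μ ≡ μ ∘ (g ⊗₁ h) → f ∘ μ ≡ μ ∘ (h ⊗₁ g)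
  factors-swap {f} {g} {h} e = begin
    f ∘ μ                 ≡⟨ cong (f ∘_) (sym μ-comm) ⟩
    f ∘ μ ∘ σ             ≡⟨ pullˡ e ⟩
    (μ ∘ (g ⊗₁ h)) ∘ σ    ≡⟨ trans assoc (sym μ-twist) ⟩
    μ ∘ (h ⊗₁ g)          ∎

  μ-assoc† : μ ∘ (id ⊗₁ μ) ≡ μ ∘ (μ ⊗₁ id) ∘ α †
  μ-assoc† = begin
    μ ∘ (id ⊗₁ μ)              ≡⟨ cong (μ ∘_) (sym identityʳ) ⟩
    μ ∘ (id ⊗₁ μ) ∘ id         ≡⟨ cong (λ h → μ ∘ (id ⊗₁ μ) ∘ h) (sym α-unitaryʳ) ⟩
    μ ∘ (id ⊗₁ μ) ∘ α ∘ α †    ≡⟨ cong (μ ∘_) (sym assoc) ⟩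
    μ ∘ ((id ⊗₁ μ) ∘ α) ∘ α †  ≡⟨ pullˡ (sym μ-assoc) ⟩
    (μ ∘ (μ ⊗₁ id)) ∘ α †      ≡⟨ assoc ⟩
    μ ∘ (μ ⊗₁ id) ∘ α †        ∎

  -- Every R_y is a module map: y · (a · b) = (y · a) · b, read via factors-swap.
  Rₓ-moduleMap : ∀ y → IsModuleMap (Rₓ y)
  Rₓ-moduleMap y = factors-swap (begin
    (μ ∘ placeˡ y) ∘ μ                    ≡⟨ trans assoc (cong (μ ∘_) placeˡ-natural) ⟩
    μ ∘ (id ⊗₁ μ) ∘ placeˡ y              ≡⟨ pullˡ μ-assoc† ⟩
    (μ ∘ (μ ⊗₁ id) ∘ α †) ∘ placeˡ y      ≡⟨ trans assoc (cong (μ ∘_) assoc) ⟩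
    μ ∘ (μ ⊗₁ id) ∘ α † ∘ placeˡ y        ≡⟨ cong (λ h → μ ∘ (μ ⊗₁ id) ∘ h) placeˡ-assoc ⟩
    μ ∘ (μ ⊗₁ id) ∘ (placeˡ y ⊗₁ id)      ≡⟨ cong (μ ∘_) (sym ∘-⊗id) ⟩
    μ ∘ ((μ ∘ placeˡ y) ⊗₁ id)            ∎)

  moduleMap⇒commutant : ∀ {f} → IsModuleMap f → f ∈ Commutant 𝒜 R
  moduleMap⇒commutant {f} m _ (x , refl) = begin
    f ∘ μ ∘ placeˡ x             ≡⟨ pullˡ m ⟩
    (μ ∘ (id ⊗₁ f)) ∘ placeˡ x   ≡⟨ trans assoc (cong (μ ∘_) (sym placeˡ-natural)) ⟩
    μ ∘ placeˡ x ∘ f             ≡⟨ sym assoc ⟩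
    (μ ∘ placeˡ x) ∘ f           ∎

  μ-points : ∀ (x y : Hom I X) → μ ∘ (x ⊗₁ y) ≡ Rₓ x ∘ y ∘ λᵤ
  μ-points x y = trans (cong (μ ∘_) (sym placeˡ-point)) (sym assoc)

  -- Conversely, by well-pointedness every element of R' is a module map:
  -- both sides agree on x ⊗ y since f commutes with R_x.
  commutant⇒moduleMap : MonoidallyWellPointed 𝒜 →
                        ∀ {f} → f ∈ Commutant 𝒜 R → IsModuleMap f
  commutant⇒moduleMap wp {f} f∈R′ = wp (f ∘ μ) (μ ∘ (id ⊗₁ f)) λ x y → begin
    (f ∘ μ) ∘ (x ⊗₁ y)          ≡⟨ trans assoc (cong (f ∘_) (μ-points x y)) ⟩
    f ∘ Rₓ x ∘ y ∘ λᵤ           ≡⟨ pullˡ (f∈R′ (Rₓ x) (x , refl)) ⟩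
    (Rₓ x ∘ f) ∘ y ∘ λᵤ         ≡⟨ trans assoc (cong (Rₓ x ∘_) (sym assoc)) ⟩
    Rₓ x ∘ (f ∘ y) ∘ λᵤ         ≡⟨ sym (μ-points x (f ∘ y)) ⟩
    μ ∘ (x ⊗₁ (f ∘ y))          ≡⟨ cong (μ ∘_) (trans (cong (_⊗₁ (f ∘ y)) (sym identityˡ)) ⊗-∘) ⟩
    μ ∘ (id ⊗₁ f) ∘ (x ⊗₁ y)    ≡⟨ sym assoc ⟩
    (μ ∘ (id ⊗₁ f)) ∘ (x ⊗₁ y)  ∎

  -- Since μ ∘ μ† = id, the composite of module maps is μ ∘ (f ⊗ g) ∘ μ†.
  moduleMap-sandwich : ∀ {f g} → IsModuleMap f → IsModuleMap g →
                       f ∘ g ≡ μ ∘ (f ⊗₁ g) ∘ μ †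
  moduleMap-sandwich {f} {g} mf mg = begin
    f ∘ g                        ≡⟨ cong (f ∘_) (trans (sym identityʳ) (cong (g ∘_) (sym μ-S))) ⟩
    f ∘ g ∘ μ ∘ μ †              ≡⟨ cong (f ∘_) (pullˡ mg) ⟩
    f ∘ (μ ∘ (id ⊗₁ g)) ∘ μ †    ≡⟨ trans (cong (f ∘_) assoc) (pullˡ (factors-swap mf)) ⟩
    (μ ∘ (f ⊗₁ id)) ∘ (id ⊗₁ g) ∘ μ † ≡⟨ trans assoc (cong (μ ∘_) (pullˡ interchangeˡ)) ⟩
    μ ∘ (f ⊗₁ g) ∘ μ †           ∎

  σ-μ† : σ ∘ μ † ≡ μ †
  σ-μ† = begin
    σ ∘ μ †            ≡⟨ cong (λ h → σ ∘ h †) (sym μ-comm) ⟩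
    σ ∘ (μ ∘ σ) †      ≡⟨ cong (σ ∘_) †-∘ ⟩
    σ ∘ σ † ∘ μ †      ≡⟨ pullˡ σ-unitaryʳ ⟩
    id ∘ μ †           ≡⟨ identityˡ ⟩
    μ †                ∎

  -- Module maps commute with each other, as the sandwich is symmetric.
  moduleMaps-commute : ∀ {f g} → IsModuleMap f → IsModuleMap g → f ∘ g ≡ g ∘ f
  moduleMaps-commute {f} {g} mf mg = begin
    f ∘ g                  ≡⟨ moduleMap-sandwich mf mg ⟩
    μ ∘ (f ⊗₁ g) ∘ μ †     ≡⟨ pullˡ μ-twist ⟩
    (μ ∘ (g ⊗₁ f) ∘ σ) ∘ μ † ≡⟨ trans assoc (cong (μ ∘_) (trans assoc (cong ((g ⊗₁ f) ∘_) σ-μ†))) ⟩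
    μ ∘ (g ⊗₁ f) ∘ μ †     ≡⟨ sym (moduleMap-sandwich mg mf) ⟩
    g ∘ f                  ∎

  -- Axiom (H) identifies R_x† with R_y for the point y = x̃†.
  Rₓ-dagger : ∀ x → Rₓ x † ≡ Rₓ (proj₁ (μ-H x) †)
  Rₓ-dagger x = begin
    Rₓ x †                           ≡⟨ cong _† (proj₂ (μ-H x)) ⟩
    (ρ ∘ (id ⊗₁ x̃) ∘ μ †) †          ≡⟨ trans †-∘ (cong (_∘ ρ †) †-∘) ⟩
    (μ † † ∘ (id ⊗₁ x̃) †) ∘ ρ †      ≡⟨ cong (_∘ ρ †) (cong₂ _∘_ †-invol †-id⊗) ⟩
    (μ ∘ (id ⊗₁ x̃ †)) ∘ ρ †          ≡⟨ trans assoc (cong (_∘ ((id ⊗₁ x̃ †) ∘ ρ †)) (sym μ-comm)) ⟩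
    (μ ∘ σ) ∘ (id ⊗₁ x̃ †) ∘ ρ †      ≡⟨ trans assoc (cong (μ ∘_) σ-placeʳ) ⟩
    μ ∘ placeˡ (x̃ †)                 ∎
    where x̃ = proj₁ (μ-H x)

  R-†-closed : ∀ {g} → g ∈ R → g † ∈ R
  R-†-closed (x , refl) = proj₁ (μ-H x) † , Rₓ-dagger x

  -- R is commutative, since each R_y is a module map.
  R-commutative : R ⊆ Commutant 𝒜 R
  R-commutative (y , refl) = moduleMap⇒commutant (Rₓ-moduleMap y)

  -- With a unit η, a module map is determined by its value on η: f = R_{f η}.
  moduleMap-from-unit : UnitAxiom 𝒜 H → ∀ {f} → IsModuleMap f → f ∈ R
  moduleMap-from-unit (η , η-unitˡ , _) {f} m = f ∘ η , (begin
    f                               ≡⟨ trans (sym identityʳ) (cong (f ∘_) (sym η-unitˡ)) ⟩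
    f ∘ μ ∘ placeˡ η                ≡⟨ trans (pullˡ (factors-swap m)) assoc ⟩
    μ ∘ (f ⊗₁ id) ∘ (η ⊗₁ id) ∘ λᵤ † ≡⟨ cong (μ ∘_) (pullˡ (sym ∘-⊗id)) ⟩
    μ ∘ ((f ∘ η) ⊗₁ id) ∘ λᵤ †      ∎)

theorem17 : ∀ {o ℓ : Level} (𝒜 : DaggerSMC o ℓ) → MonoidallyWellPointed 𝒜 →
    (Bp : DaggerBiproducts 𝒜) → {X : DaggerSMC.Obj 𝒜} → (H : HStarAlgebra 𝒜 X) →
    IsMaximalCommVonNeumann 𝒜 Bp (Commutant 𝒜 (Rμ 𝒜 H))
    × (UnitAxiom 𝒜 H → Rμ 𝒜 H ≐ Commutant 𝒜 (Rμ 𝒜 H))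
theorem17 𝒜 wp Bp H =
    commutant-maximalVonNeumann Bp R-†-closed R-commutative R′-commutative
  , λ unit → R-commutative , λ f∈R′ → moduleMap-from-unit unit (commutant⇒moduleMap wp f∈R′)
  where
  open Commutants 𝒜
  open HStarAlgebraProperties 𝒜 H

  -- R' is commutative because its elements are module maps.
  R′-commutative : IsCommutative 𝒜 Bp (Commutant 𝒜 R)
  R′-commutative f∈R′ g∈R′ =
    moduleMaps-commute (commutant⇒moduleMap wp f∈R′) (commutant⇒moduleMap wp g∈R′)
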